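{- There is no value-agnostic algorithm for Graphical House Allocation on complete binary trees that attains an approximation ratio better than $5/3$; that is, for every $\alpha<5/3$, no value-agnostic algorithm defined on the class of complete binary trees is an $\alpha$-approximation.
   Context: An instance of Graphical House Allocation is a pair $(G,H)$, where $G=(V,E)$ is an undirected simple graph on $n$ vertices and $H=\{h_1\le\dots\le h_n\}$ is a multiset of nonnegative real numbers. An allocation is a bijection $\pi:V\to H$ (counting multiplicity). Its envy is $\mathrm{Envy}(\pi,G)=\sum_{(i,j)\in E}|\pi(i)-\pi(j)|$. An algorithm on a graph class $\mathcal G$ is an $\alpha$-approximation if on every instance $(G,H)$ with $G\in\mathcal G$ it outputs an allocation whose envy is at most $\alpha$ times the minimum envy over all allocations. An algorithm is value-agnostic if it returns the same allocation on all instances with the same graph and the same ordering of house values: for each $G$ it uses a fixed ordering $(v_1,\dots,v_n)$ of $V$, depending only on $G$, and gives $h_j$ to $v_j$ for all $j$, irrespective of the numerical values (no restriction on running time). The complete binary tree $B_k$ is the rooted binary tree of depth $k$ with $2^{k+1}-1$ vertices, in which every internal node has two children and all $2^k$ leaves are at depth $k$. -}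

module Defs where

open import Data.Bool.Base using (if_then_else_)
open import Data.Fin.Base as Fin using (Fin)
import Data.Fin.Properties as Fin
open import Data.Nat.Base as ℕ using (ℕ; zero; suc)
import Data.Nat.Properties as ℕ
open import Data.Product.Base using (Σ-syntax; ∃-syntax; _×_; _,_)
open import Data.Rational.Base as ℚ using (ℚ; 0ℚ; 1ℚ; ½)
import Data.Rational.Properties as ℚ
open import Data.Rational.Solver using (module +-*-Solver)
open import Data.Sum.Base as Sum using (_⊎_; inj₁; inj₂; [_,_])
open import Data.Sum.Function.Propositional using (_⊎-↔_)
open import Data.Unit.Base using (⊤; tt)
open import Data.Vec.Functional using (foldr)
open import Function.Bundles using (_↔_; _⇔_; mk↔ₛ′; module Inverse)
open import Function.Construct.Composition using (_↔-∘_)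
open import Level using (0ℓ)
open import Relation.Binary.Core using (Rel)
open import Relation.Binary.Definitions using (Decidable; Irreflexive; Symmetric)
open import Relation.Binary.PropositionalEquality
  using (_≡_; refl; sym; trans; cong; cong₂; subst)
open import Relation.Nullary using (¬_; yes; no; does)
open import Relation.Nullary.Decidable using (_×-dec_; _⊎-dec_; map′)

------------------------------------------------------------------------
-- The real numbers, as Cauchy sequences of rationals.  There is no
-- quotient: `_≃_` is the equality of real numbers.

record ℝ : Set where
  constructor mkℝ
  field
    seq    : ℕ → ℚ
    cauchy : ∀ ε → 0ℚ ℚ.< ε → ∃[ N ] (∀ m n → N ℕ.≤ m → N ℕ.≤ n →
             ℚ.∣ seq m ℚ.- seq n ∣ ℚ.≤ ε)

open ℝ public

infix  4 _≤_ _<_ _≃_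
infix  8 -_
infixl 7 _*_
infixl 6 _+_ _-_

_≤_ : Rel ℝ 0ℓ
x ≤ y = ∀ ε → 0ℚ ℚ.< ε → ∃[ N ] (∀ n → N ℕ.≤ n → seq x n ℚ.≤ seq y n ℚ.+ ε)

_<_ : Rel ℝ 0ℓ
x < y = ∃[ ε ] (0ℚ ℚ.< ε ×
        ∃[ N ] (∀ n → N ℕ.≤ n → seq x n ℚ.+ ε ℚ.≤ seq y n))

_≃_ : Rel ℝ 0ℓ
x ≃ y = x ≤ y × y ≤ x

fromℚ : ℚ → ℝ
fromℚ q = mkℝ (λ _ → q) λ ε 0<ε → 0 , λ _ _ _ _ →
  subst (ℚ._≤ ε) (sym (cong ℚ.∣_∣ (ℚ.+-inverseʳ q))) (ℚ.<⇒≤ 0<ε)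

0ℝ : ℝ
0ℝ = fromℚ 0ℚ

private
  half-pos : ∀ ε → 0ℚ ℚ.< ε → 0ℚ ℚ.< ½ ℚ.* ε
  half-pos ε 0<ε = ℚ.*-monoʳ-<-pos ½ 0<ε

  halves : ∀ ε → ½ ℚ.* ε ℚ.+ ½ ℚ.* ε ≡ ε
  halves ε = trans (sym (ℚ.*-distribʳ-+ ε ½ ½)) (ℚ.*-identityˡ ε)

  rearrange-+ : ∀ a b c d →
    (a ℚ.+ b) ℚ.- (c ℚ.+ d) ≡ (a ℚ.- c) ℚ.+ (b ℚ.- d)
  rearrange-+ = solve 4 (λ a b c d →
    (a :+ b) :- (c :+ d) := (a :- c) :+ (b :- d)) refl
    where open +-*-Solver

  rearrange-* : ∀ a b c d →
    a ℚ.* b ℚ.- c ℚ.* d ≡ a ℚ.* (b ℚ.- d) ℚ.+ d ℚ.* (a ℚ.- c)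
  rearrange-* = solve 4 (λ a b c d →
    a :* b :- c :* d := a :* (b :- d) :+ d :* (a :- c)) refl
    where open +-*-Solver

  split : ∀ a b → a ≡ b ℚ.+ (a ℚ.- b)
  split = solve 2 (λ a b → a := b :+ (a :- b)) refl
    where open +-*-Solver

  rearrange-neg : ∀ a b → (ℚ.- a) ℚ.- (ℚ.- b) ≡ ℚ.- (a ℚ.- b)
  rearrange-neg = solve 2 (λ a b → (:- a) :- (:- b) := :- (a :- b)) refl
    where open +-*-Solver

  cancel : ∀ a b → a ℚ.+ b ℚ.- a ≡ b
  cancel = solve 2 (λ a b → a :+ b :- a := b) refl
    where open +-*-Solver

  neg-diff : ∀ a b → ℚ.- (a ℚ.- b) ≡ b ℚ.- a
  neg-diff = solve 2 (λ a b → :- (a :- b) := b :- a) refl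
    where open +-*-Solver

  abs-diff : ∀ a b → ℚ.∣ b ℚ.- a ∣ ≡ ℚ.∣ a ℚ.- b ∣
  abs-diff a b = trans (cong ℚ.∣_∣ (sym (neg-diff a b))) (ℚ.∣-p∣≡∣p∣ (a ℚ.- b))

  abs-diff-≤ : ∀ a b → ℚ.∣ a ∣ ℚ.- ℚ.∣ b ∣ ℚ.≤ ℚ.∣ a ℚ.- b ∣
  abs-diff-≤ a b = begin
    ℚ.∣ a ∣ ℚ.- ℚ.∣ b ∣
      ≡⟨ cong (λ z → ℚ.∣ z ∣ ℚ.- ℚ.∣ b ∣) (split a b) ⟩
    ℚ.∣ b ℚ.+ (a ℚ.- b) ∣ ℚ.- ℚ.∣ b ∣
      ≤⟨ ℚ.+-monoˡ-≤ (ℚ.- ℚ.∣ b ∣) (ℚ.∣p+q∣≤∣p∣+∣q∣ b (a ℚ.- b)) ⟩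
    ℚ.∣ b ∣ ℚ.+ ℚ.∣ a ℚ.- b ∣ ℚ.- ℚ.∣ b ∣
      ≡⟨ cancel ℚ.∣ b ∣ ℚ.∣ a ℚ.- b ∣ ⟩
    ℚ.∣ a ℚ.- b ∣ ∎
    where open ℚ.≤-Reasoning

  abs-lipschitz : ∀ a b → ℚ.∣ ℚ.∣ a ∣ ℚ.- ℚ.∣ b ∣ ∣ ℚ.≤ ℚ.∣ a ℚ.- b ∣
  abs-lipschitz a b with ℚ.∣p∣≡p∨∣p∣≡-p (ℚ.∣ a ∣ ℚ.- ℚ.∣ b ∣)
  ... | inj₁ eq = subst (ℚ._≤ ℚ.∣ a ℚ.- b ∣) (sym eq) (abs-diff-≤ a b)
  ... | inj₂ eq = begin
    ℚ.∣ ℚ.∣ a ∣ ℚ.- ℚ.∣ b ∣ ∣   ≡⟨ eq ⟩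
    ℚ.- (ℚ.∣ a ∣ ℚ.- ℚ.∣ b ∣)   ≡⟨ neg-diff ℚ.∣ a ∣ ℚ.∣ b ∣ ⟩
    ℚ.∣ b ∣ ℚ.- ℚ.∣ a ∣         ≤⟨ abs-diff-≤ b a ⟩
    ℚ.∣ b ℚ.- a ∣               ≡⟨ abs-diff a b ⟩
    ℚ.∣ a ℚ.- b ∣               ∎
    where open ℚ.≤-Reasoning

  -- A positive bound for a convergent sequence from some point on.
  bounded : ∀ x → ∃[ B ] (0ℚ ℚ.< B ×
            ∃[ N ] (∀ n → N ℕ.≤ n → ℚ.∣ seq x n ∣ ℚ.≤ B))
  bounded x with cauchy x 1ℚ (ℚ.positive⁻¹ 1ℚ)
  ... | N , close =
    ℚ.∣ seq x N ∣ ℚ.+ 1ℚ ,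
    ℚ.+-mono-≤-< (ℚ.0≤∣p∣ (seq x N)) (ℚ.positive⁻¹ 1ℚ) ,
    N , λ n N≤n → begin
      ℚ.∣ seq x n ∣
        ≡⟨ cong ℚ.∣_∣ (split (seq x n) (seq x N)) ⟩
      ℚ.∣ seq x N ℚ.+ (seq x n ℚ.- seq x N) ∣
        ≤⟨ ℚ.∣p+q∣≤∣p∣+∣q∣ (seq x N) (seq x n ℚ.- seq x N) ⟩
      ℚ.∣ seq x N ∣ ℚ.+ ℚ.∣ seq x n ℚ.- seq x N ∣
        ≤⟨ ℚ.+-monoʳ-≤ ℚ.∣ seq x N ∣ (close n N N≤n ℕ.≤-refl) ⟩
      ℚ.∣ seq x N ∣ ℚ.+ 1ℚ ∎
    where open ℚ.≤-Reasoning

  divide : ∀ B ε → 0ℚ ℚ.< B → 0ℚ ℚ.< ε → ∃[ δ ] (0ℚ ℚ.< δ × B ℚ.* δ ≡ ε)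
  divide B ε 0<B 0<ε =
    1/B ℚ.* ε ,
    ℚ.positive⁻¹ (1/B ℚ.* ε) {{ℚ.pos*pos⇒pos 1/B {{1/B⁺}} ε {{ℚ.positive 0<ε}}}} ,
    trans (sym (ℚ.*-assoc B 1/B ε))
      (trans (cong (ℚ._* ε) (ℚ.*-inverseʳ B {{B≢0}})) (ℚ.*-identityˡ ε))
    where
    B⁺ : ℚ.Positive B
    B⁺ = ℚ.positive 0<B
    B≢0 : ℚ.NonZero B
    B≢0 = ℚ.pos⇒nonZero B {{B⁺}}
    1/B : ℚ
    1/B = (ℚ.1/ B) {{B≢0}}
    1/B⁺ : ℚ.Positive 1/B
    1/B⁺ = ℚ.1/pos⇒pos B {{B⁺}}

  product-≤ : ∀ a d {B δ} → ℚ.∣ a ∣ ℚ.≤ B → 0ℚ ℚ.≤ B → ℚ.∣ d ∣ ℚ.≤ δ →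
              ℚ.∣ a ℚ.* d ∣ ℚ.≤ B ℚ.* δ
  product-≤ a d {B} {δ} a≤B 0≤B d≤δ = begin
    ℚ.∣ a ℚ.* d ∣         ≡⟨ ℚ.∣p*q∣≡∣p∣*∣q∣ a d ⟩
    ℚ.∣ a ∣ ℚ.* ℚ.∣ d ∣   ≤⟨ ℚ.*-monoʳ-≤-nonNeg ℚ.∣ d ∣ {{ℚ.∣-∣-nonNeg d}} a≤B ⟩
    B ℚ.* ℚ.∣ d ∣         ≤⟨ ℚ.*-monoˡ-≤-nonNeg B {{ℚ.nonNegative 0≤B}} d≤δ ⟩
    B ℚ.* δ               ∎
    where open ℚ.≤-Reasoning

_+_ : ℝ → ℝ → ℝ
x + y = mkℝ (λ n → seq x n ℚ.+ seq y n) λ ε 0<ε →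
  let M , closeˣ = cauchy x (½ ℚ.* ε) (half-pos ε 0<ε)
      N , closeʸ = cauchy y (½ ℚ.* ε) (half-pos ε 0<ε)
  in M ℕ.⊔ N , λ m n ≤m ≤n → begin
    ℚ.∣ (seq x m ℚ.+ seq y m) ℚ.- (seq x n ℚ.+ seq y n) ∣
      ≡⟨ cong ℚ.∣_∣ (rearrange-+ (seq x m) (seq y m) (seq x n) (seq y n)) ⟩
    ℚ.∣ (seq x m ℚ.- seq x n) ℚ.+ (seq y m ℚ.- seq y n) ∣
      ≤⟨ ℚ.∣p+q∣≤∣p∣+∣q∣ (seq x m ℚ.- seq x n) (seq y m ℚ.- seq y n) ⟩
    ℚ.∣ seq x m ℚ.- seq x n ∣ ℚ.+ ℚ.∣ seq y m ℚ.- seq y n ∣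
      ≤⟨ ℚ.+-mono-≤
           (closeˣ m n (ℕ.m⊔n≤o⇒m≤o M N ≤m) (ℕ.m⊔n≤o⇒m≤o M N ≤n))
           (closeʸ m n (ℕ.m⊔n≤o⇒n≤o M N ≤m) (ℕ.m⊔n≤o⇒n≤o M N ≤n)) ⟩
    ½ ℚ.* ε ℚ.+ ½ ℚ.* ε
      ≡⟨ halves ε ⟩
    ε ∎
  where open ℚ.≤-Reasoning

-_ : ℝ → ℝ
- x = mkℝ (λ n → ℚ.- seq x n) λ ε 0<ε →
  let N , close = cauchy x ε 0<ε
  in N , λ m n ≤m ≤n → subst (ℚ._≤ ε)
    (trans (sym (ℚ.∣-p∣≡∣p∣ (seq x m ℚ.- seq x n)))
           (cong ℚ.∣_∣ (sym (rearrange-neg (seq x m) (seq x n)))))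
    (close m n ≤m ≤n)

_-_ : ℝ → ℝ → ℝ
x - y = x + (- y)

∣_∣ : ℝ → ℝ
∣ x ∣ = mkℝ (λ n → ℚ.∣ seq x n ∣) λ ε 0<ε →
  let N , close = cauchy x ε 0<ε
  in N , λ m n ≤m ≤n →
    ℚ.≤-trans (abs-lipschitz (seq x m) (seq x n)) (close m n ≤m ≤n)

_*_ : ℝ → ℝ → ℝ
x * y = mkℝ (λ n → seq x n ℚ.* seq y n) λ ε 0<ε →
  let A , 0<A , K , ≤A = bounded x
      B , 0<B , L , ≤B = bounded y
      δ , 0<δ , A*δ≡ = divide A (½ ℚ.* ε) 0<A (half-pos ε 0<ε)
      η , 0<η , B*η≡ = divide B (½ ℚ.* ε) 0<B (half-pos ε 0<ε)
      M , closeˣ = cauchy x η 0<η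
      N , closeʸ = cauchy y δ 0<δ
      K⊔L = K ℕ.⊔ L
      M⊔N = M ℕ.⊔ N
      ≤K⊔L = λ {n} (≤n : K⊔L ℕ.⊔ M⊔N ℕ.≤ n) → ℕ.m⊔n≤o⇒m≤o K⊔L M⊔N ≤n
      ≤M⊔N = λ {n} (≤n : K⊔L ℕ.⊔ M⊔N ℕ.≤ n) → ℕ.m⊔n≤o⇒n≤o K⊔L M⊔N ≤n
      boundˣ = λ n ≤n → ≤A n (ℕ.m⊔n≤o⇒m≤o K L (≤K⊔L ≤n))
      boundʸ = λ n ≤n → ≤B n (ℕ.m⊔n≤o⇒n≤o K L (≤K⊔L ≤n))
  in K⊔L ℕ.⊔ M⊔N , λ m n ≤m ≤n →
  let xm = seq x m ; xn = seq x n ; ym = seq y m ; yn = seq y n in begin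
    ℚ.∣ xm ℚ.* ym ℚ.- xn ℚ.* yn ∣
      ≡⟨ cong ℚ.∣_∣ (rearrange-* xm ym xn yn) ⟩
    ℚ.∣ xm ℚ.* (ym ℚ.- yn) ℚ.+ yn ℚ.* (xm ℚ.- xn) ∣
      ≤⟨ ℚ.∣p+q∣≤∣p∣+∣q∣ (xm ℚ.* (ym ℚ.- yn)) (yn ℚ.* (xm ℚ.- xn)) ⟩
    ℚ.∣ xm ℚ.* (ym ℚ.- yn) ∣ ℚ.+ ℚ.∣ yn ℚ.* (xm ℚ.- xn) ∣
      ≤⟨ ℚ.+-mono-≤
           (product-≤ xm (ym ℚ.- yn) (boundˣ m ≤m) (ℚ.<⇒≤ 0<A)
             (closeʸ m n (ℕ.m⊔n≤o⇒n≤o M N (≤M⊔N ≤m)) (ℕ.m⊔n≤o⇒n≤o M N (≤M⊔N ≤n))))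
           (product-≤ yn (xm ℚ.- xn) (boundʸ n ≤n) (ℚ.<⇒≤ 0<B)
             (closeˣ m n (ℕ.m⊔n≤o⇒m≤o M N (≤M⊔N ≤m)) (ℕ.m⊔n≤o⇒m≤o M N (≤M⊔N ≤n)))) ⟩
    A ℚ.* δ ℚ.+ B ℚ.* η
      ≡⟨ cong₂ ℚ._+_ A*δ≡ B*η≡ ⟩
    ½ ℚ.* ε ℚ.+ ½ ℚ.* ε
      ≡⟨ halves ε ⟩
    ε ∎
  where open ℚ.≤-Reasoning

sum : ∀ {n} → (Fin n → ℝ) → ℝ
sum = foldr _+_ 0ℝ

------------------------------------------------------------------------
-- Graphs

record Graph : Set₁ where
  infix 4 _~_ _~?_
  field
    V        : Set
    size     : ℕ
    vertices : Fin size ↔ V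
    _~_      : Rel V 0ℓ
    _~?_     : Decidable _~_
    ~-sym    : Symmetric _~_
    ~-irrefl : Irreflexive _≡_ _~_

  vertex : Fin size → V
  vertex = Inverse.to vertices

record _≅_ (G H : Graph) : Set where
  private
    module G = Graph G
    module H = Graph H
  field
    bijection : G.V ↔ H.V
    preserves : ∀ u v → (u G.~ v) ⇔ (Inverse.to bijection u H.~ Inverse.to bijection v)

GraphClass : Set₁
GraphClass = Graph → Set

------------------------------------------------------------------------
-- Complete binary trees

data Node : ℕ → Set where
  root       : ∀ {k} → Node k
  left right : ∀ {k} → Node k → Node (suc k)

-- `Child x y` says that y is a child of x.
data Child : ∀ {k} → Node k → Node k → Set where
  left-root  : ∀ {k} → Child {suc k} root (left root)
  right-root : ∀ {k} → Child {suc k} root (right root)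
  left       : ∀ {k} {x y : Node k} → Child x y → Child (left x) (left y)
  right      : ∀ {k} {x y : Node k} → Child x y → Child (right x) (right y)

child? : ∀ {k} → Decidable (Child {k})
child? root            root            = no λ ()
child? root            (left root)     = yes left-root
child? root            (left (left _))  = no λ ()
child? root            (left (right _)) = no λ ()
child? root            (right root)    = yes right-root
child? root            (right (left _))  = no λ ()
child? root            (right (right _)) = no λ ()
child? (left x)        root            = no λ ()
child? (left x)        (left y)        = map′ left (λ { (left c) → c }) (child? x y)
child? (left x)        (right y)       = no λ ()
child? (right x)       root            = no λ ()
child? (right x)       (left y)        = no λ ()
child? (right x)       (right y)       = map′ right (λ { (right c) → c }) (child? x y)

child-irrefl : ∀ {k} {x : Node k} → ¬ Child x x
child-irrefl (left c)  = child-irrefl c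
child-irrefl (right c) = child-irrefl c

#nodes : ℕ → ℕ
#nodes zero    = 1
#nodes (suc k) = 1 ℕ.+ (#nodes k ℕ.+ #nodes k)

#nodes≡2^[k+1]∸1 : ∀ k → #nodes k ≡ 2 ℕ.^ suc k ℕ.∸ 1
#nodes≡2^[k+1]∸1 k = cong ℕ.pred (lemma k)
  where
  lemma : ∀ k → suc (#nodes k) ≡ 2 ℕ.^ suc k
  lemma zero    = refl
  lemma (suc k) = trans (cong suc (sym (ℕ.+-suc (#nodes k) (#nodes k))))
    (trans (cong₂ ℕ._+_ (lemma k) (lemma k))
           (cong (2 ℕ.^ suc k ℕ.+_) (sym (ℕ.+-identityʳ (2 ℕ.^ suc k)))))

-- The preorder numbering.
nodes : ∀ k → Fin (#nodes k) ↔ Node k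
nodes zero    = mk↔ₛ′ (λ _ → root) (λ _ → Fin.zero)
                      (λ { root → refl }) (λ { Fin.zero → refl ; (Fin.suc ()) })
nodes (suc k) = assemble ↔-∘ ((Fin.1↔⊤ ⊎-↔ ((nodes k ⊎-↔ nodes k) ↔-∘ Fin.+↔⊎)) ↔-∘ Fin.+↔⊎)
  where
  assemble : (⊤ ⊎ (Node k ⊎ Node k)) ↔ Node (suc k)
  assemble = mk↔ₛ′
    (λ { (inj₁ tt) → root ; (inj₂ (inj₁ x)) → left x ; (inj₂ (inj₂ x)) → right x })
    (λ { root → inj₁ tt ; (left x) → inj₂ (inj₁ x) ; (right x) → inj₂ (inj₂ x) })
    (λ { root → refl ; (left _) → refl ; (right _) → refl })
    (λ { (inj₁ tt) → refl ; (inj₂ (inj₁ _)) → refl ; (inj₂ (inj₂ _)) → refl })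

B : ℕ → Graph
B k = record
  { V        = Node k
  ; size     = #nodes k
  ; vertices = nodes k
  ; _~_      = λ x y → Child x y ⊎ Child y x
  ; _~?_     = λ x y → child? x y ⊎-dec child? y x
  ; ~-sym    = Sum.swap
  ; ~-irrefl = λ { refl → [ child-irrefl , child-irrefl ] }
  }

CompleteBinaryTree : GraphClass
CompleteBinaryTree G = ∃[ k ] (G ≅ B k)

------------------------------------------------------------------------
-- House allocation

-- A multiset of n nonnegative reals, listed in increasing order.
record Houses (n : ℕ) : Set where
  field
    value  : Fin n → ℝ
    nonneg : ∀ j → 0ℝ ≤ value j
    sorted : ∀ {i j} → i Fin.≤ j → value i ≤ value j

open Houses public

-- Houses are referred to by their position in the sorted list, so that
-- houses of equal value remain distinct.
Allocation : Graph → Set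
Allocation G = V ↔ Fin size
  where open Graph G

-- Each edge is counted once: at the pair of positions i < j of its
-- endpoints in the enumeration of the vertices.
envy : (G : Graph) → Houses (Graph.size G) → Allocation G → ℝ
envy G H π = sum λ i → sum λ j →
  if does (i Fin.<? j ×-dec vertex i ~? vertex j)
  then ∣ h (vertex i) - h (vertex j) ∣
  else 0ℝ
  where
  open Graph G
  h : V → ℝ
  h v = value H (Inverse.to π v)

IsMinimumEnvy : (G : Graph) → Houses (Graph.size G) → ℝ → Set
IsMinimumEnvy G H m =
  (∃[ π ] envy G H π ≃ m) × (∀ π → m ≤ envy G H π)

-- Membership of G in the class is irrelevant: the output depends on the
-- instance (G , H) only.
Algorithm : GraphClass → Set₁
Algorithm 𝒢 = (G : Graph) → .(𝒢 G) → Houses (Graph.size G) → Allocation G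

IsApproximation : ∀ {𝒢} → ℝ → Algorithm 𝒢 → Set₁
IsApproximation {𝒢} α A =
  ∀ G (G∈𝒢 : 𝒢 G) H m → IsMinimumEnvy G H m → envy G H (A G G∈𝒢 H) ≤ α * m

-- `order` is the sequence (v₁ , … , vₙ) of the vertices of G.
ValueAgnostic : ∀ {𝒢} → Algorithm 𝒢 → Set₁
ValueAgnostic {𝒢} A =
  ∀ G (G∈𝒢 : 𝒢 G) → Σ[ order ∈ Fin (Graph.size G) ↔ Graph.V G ]
    ∀ H j → Inverse.to (A G G∈𝒢 H) (Inverse.to order j) ≡ j

{-# OPTIONS --safe #-}

-- On the instances with t houses of value 0 and all others of value 1, the envy of an
-- allocation is the cut of the set of the t vertices that receive the houses of value 0,
-- and a value-agnostic algorithm produces a nested family of such sets.  Every cut edge of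
-- a set X that avoids the root contributes the size 2^{d+1} − 1 of the subtree below it to |X|, with
-- sign + or − according to whether the child or the parent is in X.  In B 8 the optimum is
-- at most 2 for t = 94 and at most 3 for t = 89, so that a ratio below 5/3 forces cuts of
-- at most 3 and at most 4.  For 94 this forces the set to be a disjoint union of subtrees
-- of sizes 63 and 31, whereas for 89 it needs a node whose subtree has 127 nodes, so the
-- two sets are not nested.
module Submission where

open import Defs
open import Data.Integer.Base using (+_)
open import Data.Rational.Base using (_/_)
open import Relation.Nullary using (¬_)

import Algebra.Properties.CommutativeMonoid.Sum as Sum
open import Data.Bool.Base using (Bool; true; false; not; _xor_; if_then_else_)
open import Data.Bool.Properties using (T-≡)
open import Data.Empty using (⊥)
open import Data.Fin.Base as Fin using (Fin; toℕ; _↑ˡ_; _↑ʳ_)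
open import Data.Fin.Permutation as Perm using (Permutation′; _⟨$⟩ʳ_)
import Data.Fin.Properties as Fin
open import Data.List.Base using (List; []; _∷_; _++_; length)
import Data.List.Properties as List
open import Data.List.Relation.Unary.All as All using (All; []; _∷_)
import Data.List.Relation.Unary.All.Properties as All
open import Data.Nat.Base as ℕ using (ℕ; zero; suc; z≤n; s≤s; s≤s⁻¹)
open import Data.Nat.Induction using (<-wellFounded)
import Data.Nat.Properties as ℕ
open import Data.Nat.Solver using (module +-*-Solver)
open import Data.Product.Base using (Σ-syntax; ∃-syntax; _×_; _,_; proj₁; proj₂)
open import Data.Rational.Base as ℚ using (ℚ; 0ℚ; 1ℚ; ½)
import Data.Rational.Properties as ℚ
open import Data.Sum.Base using (inj₁; inj₂)
open import Function.Base using (_∘_; id)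
open import Function.Bundles using (_↔_; module Equivalence; module Inverse; mk⇔)
open import Function.Construct.Composition using (_↔-∘_)
open import Function.Construct.Identity using (↔-id)
open import Function.Construct.Symmetry using (↔-sym)
open import Induction.WellFounded using (Acc; acc)
open import Relation.Binary.PropositionalEquality
open import Relation.Nullary using (Dec; yes; no; does; contradiction)
open import Relation.Nullary.Decidable
  using (¬?; _×-dec_; _→-dec_; map′; does-⇔; from-yes; dec-true; dec-false; decidable-stable)

open Sum ℕ.+-0-commutativeMonoid
  using (sum-cong-≗; sum-permute; sum-replicate-zero) renaming (sum to Σ)

bit : Bool → ℕ
bit b = if b then 1 else 0

-- Sums over the nodes of a tree

Σᵀ : ∀ {k} → (Node k → ℕ) → ℕ
Σᵀ {zero}  f = f root
Σᵀ {suc k} f = f root ℕ.+ (Σᵀ (f ∘ left) ℕ.+ Σᵀ (f ∘ right))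

Σᵀ-cong : ∀ {k} {f g : Node k → ℕ} → (∀ x → f x ≡ g x) → Σᵀ f ≡ Σᵀ g
Σᵀ-cong {zero}  eq = eq root
Σᵀ-cong {suc k} eq =
  cong₂ ℕ._+_ (eq root) (cong₂ ℕ._+_ (Σᵀ-cong (eq ∘ left)) (Σᵀ-cong (eq ∘ right)))

Σᵀ-zero : ∀ k → Σᵀ {k} (λ _ → 0) ≡ 0
Σᵀ-zero zero    = refl
Σᵀ-zero (suc k) = cong₂ ℕ._+_ (Σᵀ-zero k) (Σᵀ-zero k)

Σ-++ : ∀ m {n} (f : Fin (m ℕ.+ n) → ℕ) →
       Σ f ≡ Σ (λ i → f (i ↑ˡ n)) ℕ.+ Σ (λ i → f (m ↑ʳ i))
Σ-++ zero    f = refl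
Σ-++ (suc m) f = trans (cong (f Fin.zero ℕ.+_) (Σ-++ m (f ∘ Fin.suc)))
                       (sym (ℕ.+-assoc (f Fin.zero) _ _))

node : ∀ {k} → Fin (#nodes k) → Node k
node {k} = Inverse.to (nodes k)

index : ∀ {k} → Node k → Fin (#nodes k)
index {k} = Inverse.from (nodes k)

node-↑ˡ : ∀ {k} (i : Fin (#nodes k)) →
          node {suc k} (Fin.suc (i ↑ˡ #nodes k)) ≡ left (node i)
node-↑ˡ {k} i rewrite Fin.splitAt-↑ˡ (#nodes k) i (#nodes k) = refl

node-↑ʳ : ∀ {k} (i : Fin (#nodes k)) →
          node {suc k} (Fin.suc (#nodes k ↑ʳ i)) ≡ right (node i)
node-↑ʳ {k} i rewrite Fin.splitAt-↑ʳ (#nodes k) (#nodes k) i = refl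

Σ-node : ∀ {k} (f : Node k → ℕ) → Σ (f ∘ node) ≡ Σᵀ f
Σ-node {zero}  f = ℕ.+-identityʳ (f root)
Σ-node {suc k} f = cong (f root ℕ.+_) (trans (Σ-++ (#nodes k) _) (cong₂ ℕ._+_
  (trans (sum-cong-≗ (cong f ∘ node-↑ˡ)) (Σ-node (f ∘ left)))
  (trans (sum-cong-≗ (cong f ∘ node-↑ʳ)) (Σ-node (f ∘ right)))))

index-mono : ∀ {k} {x y : Node k} → Child x y → index x Fin.< index y
index-mono left-root  = s≤s z≤n
index-mono right-root = s≤s z≤n
index-mono {suc k} (left {x = x} {y} c)
  rewrite Fin.toℕ-↑ˡ (index x) (#nodes k) | Fin.toℕ-↑ˡ (index y) (#nodes k) =
  s≤s (index-mono c)
index-mono {suc k} (right {x = x} {y} c)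
  rewrite Fin.toℕ-↑ʳ (#nodes k) (index x) | Fin.toℕ-↑ʳ (#nodes k) (index y) =
  s≤s (ℕ.+-monoʳ-< (#nodes k) (index-mono c))

node-mono : ∀ {k} {i j : Fin (#nodes k)} → Child (node i) (node j) → i Fin.< j
node-mono {k} {i} {j} c = subst₂ Fin._<_
  (Inverse.strictlyInverseʳ (nodes k) i) (Inverse.strictlyInverseʳ (nodes k) j)
  (index-mono {k} c)

-- Sets of nodes

NodeSet : ℕ → Set
NodeSet k = Node k → Bool

size : ∀ {k} → NodeSet k → ℕ
size X = Σᵀ (bit ∘ X)

cutBelow : ∀ {k} → NodeSet k → Node k → ℕ
cutBelow X x = Σᵀ λ y → if does (child? x y) then bit (X x xor X y) else 0

cut : ∀ {k} → NodeSet k → ℕ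
cut X = Σᵀ (cutBelow X)

-- An edge between X and its complement, labelled by the depth d of the complete
-- subtree below it: `gain d` if the child is in X, `loss d` if the parent is.
data CutEdge : Set where
  gain loss : ℕ → CutEdge

link : Bool → Bool → ℕ → List CutEdge
link false true  d = gain d ∷ []
link true  false d = loss d ∷ []
link false false d = []
link true  true  d = []

cutEdges : ∀ {k} → NodeSet k → List CutEdge
cutEdges {zero}  X = []
cutEdges {suc k} X =
  (link (X root) (X (left root)) k ++ link (X root) (X (right root)) k) ++
  (cutEdges (X ∘ left) ++ cutEdges (X ∘ right))

length-link : ∀ a b d → length (link a b d) ≡ bit (a xor b)
length-link false false d = refl
length-link false true  d = refl
length-link true  false d = refl
length-link true  true  d = refl

Σᵀ-left-child : ∀ {k} (f : Node k → ℕ) →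
  Σᵀ (λ y → if does (child? root (left y)) then f y else 0) ≡ f root
Σᵀ-left-child {zero}  f = refl
Σᵀ-left-child {suc k} f =
  trans (cong (f root ℕ.+_) (cong₂ ℕ._+_ (Σᵀ-zero k) (Σᵀ-zero k))) (ℕ.+-identityʳ (f root))

Σᵀ-right-child : ∀ {k} (f : Node k → ℕ) →
  Σᵀ (λ y → if does (child? root (right y)) then f y else 0) ≡ f root
Σᵀ-right-child {zero}  f = refl
Σᵀ-right-child {suc k} f =
  trans (cong (f root ℕ.+_) (cong₂ ℕ._+_ (Σᵀ-zero k) (Σᵀ-zero k))) (ℕ.+-identityʳ (f root))

cut≡length : ∀ {k} (X : NodeSet k) → cut X ≡ length (cutEdges X)
cut≡length {zero}  X = refl
cut≡length {suc k} X = begin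
  cut X
    -- The root sees only its two children, and a node of one subtree has no children in the other,
    -- so that half of its sum vanishes.
    ≡⟨ cong₂ ℕ._+_
         (cong₂ ℕ._+_ (Σᵀ-left-child (λ y → bit (X root xor X (left y))))
                      (Σᵀ-right-child (λ y → bit (X root xor X (right y)))))
         (cong₂ ℕ._+_
           (Σᵀ-cong λ x → trans (cong (cutBelow (X ∘ left) x ℕ.+_) (Σᵀ-zero k))
                                (ℕ.+-identityʳ (cutBelow (X ∘ left) x)))
           (Σᵀ-cong λ x → cong (ℕ._+ cutBelow (X ∘ right) x) (Σᵀ-zero k))) ⟩
  (bit (X root xor X (left root)) ℕ.+ bit (X root xor X (right root))) ℕ.+
  (cut (X ∘ left) ℕ.+ cut (X ∘ right))
    ≡⟨ cong₂ ℕ._+_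
         (cong₂ ℕ._+_ (length-link (X root) _ k) (length-link (X root) _ k))
         (cong₂ ℕ._+_ (sym (cut≡length (X ∘ left))) (sym (cut≡length (X ∘ right)))) ⟨
  (length l₁ ℕ.+ length l₂) ℕ.+
  (length (cutEdges (X ∘ left)) ℕ.+ length (cutEdges (X ∘ right)))
    ≡⟨ cong₂ ℕ._+_ (List.length-++ l₁) (List.length-++ (cutEdges (X ∘ left))) ⟨
  length (l₁ ++ l₂) ℕ.+ length (cutEdges (X ∘ left) ++ cutEdges (X ∘ right))
    ≡⟨ List.length-++ (l₁ ++ l₂) ⟨
  length (cutEdges X) ∎
  where
  open ≡-Reasoning
  l₁ = link (X root) (X (left root)) k
  l₂ = link (X root) (X (right root)) k

-- The closed form evaluates faster than #nodes, whose recursion doubles.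
weight : ℕ → ℕ
weight d = 2 ℕ.^ suc d ℕ.∸ 1

-- The size of a set in terms of its cut edges

gained lost : List CutEdge → ℕ
gained []           = 0
gained (gain d ∷ l) = weight d ℕ.+ gained l
gained (loss d ∷ l) = gained l
lost []           = 0
lost (gain d ∷ l) = lost l
lost (loss d ∷ l) = weight d ℕ.+ lost l

gained-++ : ∀ l m → gained (l ++ m) ≡ gained l ℕ.+ gained m
gained-++ []           m = refl
gained-++ (gain d ∷ l) m =
  trans (cong (weight d ℕ.+_) (gained-++ l m)) (sym (ℕ.+-assoc (weight d) _ _))
gained-++ (loss d ∷ l) m = gained-++ l m

lost-++ : ∀ l m → lost (l ++ m) ≡ lost l ℕ.+ lost m
lost-++ []           m = refl
lost-++ (gain d ∷ l) m = lost-++ l m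
lost-++ (loss d ∷ l) m =
  trans (cong (weight d ℕ.+_) (lost-++ l m)) (sym (ℕ.+-assoc (weight d) _ _))

link-balance : ∀ a b d → bit b ℕ.* weight d ℕ.+ lost (link a b d) ≡
                         bit a ℕ.* weight d ℕ.+ gained (link a b d)
link-balance false false d = refl
link-balance false true  d = solve 1 (λ w → (w :+ con 0) :+ con 0 := w :+ con 0) refl (weight d)
  where open +-*-Solver
link-balance true  false d = solve 1 (λ w → w :+ con 0 := (w :+ con 0) :+ con 0) refl (weight d)
  where open +-*-Solver
link-balance true  true  d = refl

weight-suc : ∀ k → weight (suc k) ≡ 1 ℕ.+ (weight k ℕ.+ weight k)
weight-suc k = begin
  weight (suc k)                     ≡⟨ #nodes≡2^[k+1]∸1 (suc k) ⟨
  1 ℕ.+ (#nodes k ℕ.+ #nodes k)      ≡⟨ cong (λ w → 1 ℕ.+ (w ℕ.+ w)) (#nodes≡2^[k+1]∸1 k) ⟩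
  1 ℕ.+ (weight k ℕ.+ weight k)      ∎
  where open ≡-Reasoning

-- Going down from the root, `X` starts as everything or nothing, each gain switches a whole subtree
-- on, and each loss switches one off. The losses stand on the left to avoid truncated subtraction.
balance : ∀ {k} (X : NodeSet k) →
  size X ℕ.+ lost (cutEdges X) ≡ bit (X root) ℕ.* weight k ℕ.+ gained (cutEdges X)
balance {zero}  X = cong (ℕ._+ 0) (sym (ℕ.*-identityʳ (bit (X root))))
balance {suc k} X = begin
  (r ℕ.+ (size (X ∘ left) ℕ.+ size (X ∘ right))) ℕ.+ lost (cutEdges X)
    ≡⟨ cong (r ℕ.+ (size (X ∘ left) ℕ.+ size (X ∘ right)) ℕ.+_) (expand lost lost-++) ⟩
  (r ℕ.+ (size (X ∘ left) ℕ.+ size (X ∘ right))) ℕ.+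
  ((lost l₁ ℕ.+ lost l₂) ℕ.+ (lost (cutEdges (X ∘ left)) ℕ.+ lost (cutEdges (X ∘ right))))
    ≡⟨ solve 7 (λ r s₁ s₂ m₁ m₂ n₁ n₂ →
         (r :+ (s₁ :+ s₂)) :+ ((m₁ :+ m₂) :+ (n₁ :+ n₂)) :=
         r :+ ((s₁ :+ n₁) :+ (s₂ :+ n₂)) :+ (m₁ :+ m₂)) refl
         r (size (X ∘ left)) (size (X ∘ right)) (lost l₁) (lost l₂) _ _ ⟩
  r ℕ.+ ((size (X ∘ left) ℕ.+ lost (cutEdges (X ∘ left))) ℕ.+
         (size (X ∘ right) ℕ.+ lost (cutEdges (X ∘ right)))) ℕ.+ (lost l₁ ℕ.+ lost l₂)
    ≡⟨ cong (λ z → r ℕ.+ z ℕ.+ (lost l₁ ℕ.+ lost l₂))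
         (cong₂ ℕ._+_ (balance (X ∘ left)) (balance (X ∘ right))) ⟩
  r ℕ.+ ((b₁ ℕ.* w ℕ.+ g₁) ℕ.+ (b₂ ℕ.* w ℕ.+ g₂)) ℕ.+ (lost l₁ ℕ.+ lost l₂)
    ≡⟨ solve 7 (λ r bw₁ bw₂ g₁ g₂ m₁ m₂ →
         r :+ ((bw₁ :+ g₁) :+ (bw₂ :+ g₂)) :+ (m₁ :+ m₂) :=
         r :+ ((bw₁ :+ m₁) :+ (bw₂ :+ m₂)) :+ (g₁ :+ g₂)) refl
         r (b₁ ℕ.* w) (b₂ ℕ.* w) g₁ g₂ (lost l₁) (lost l₂) ⟩
  r ℕ.+ ((b₁ ℕ.* w ℕ.+ lost l₁) ℕ.+ (b₂ ℕ.* w ℕ.+ lost l₂)) ℕ.+ (g₁ ℕ.+ g₂)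
    -- The edges at the root replace the children's membership by that of the root, which then
    -- accounts for all 1 + 2w nodes.
    ≡⟨ cong (λ z → r ℕ.+ z ℕ.+ (g₁ ℕ.+ g₂))
         (cong₂ ℕ._+_ (link-balance (X root) (X (left root)) k)
                      (link-balance (X root) (X (right root)) k)) ⟩
  r ℕ.+ ((r ℕ.* w ℕ.+ gained l₁) ℕ.+ (r ℕ.* w ℕ.+ gained l₂)) ℕ.+ (g₁ ℕ.+ g₂)
    ≡⟨ solve 6 (λ r w p₁ p₂ g₁ g₂ →
         r :+ ((r :* w :+ p₁) :+ (r :* w :+ p₂)) :+ (g₁ :+ g₂) :=
         r :* (con 1 :+ (w :+ w)) :+ ((p₁ :+ p₂) :+ (g₁ :+ g₂))) refl
         r w (gained l₁) (gained l₂) g₁ g₂ ⟩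
  r ℕ.* (1 ℕ.+ (w ℕ.+ w)) ℕ.+ ((gained l₁ ℕ.+ gained l₂) ℕ.+ (g₁ ℕ.+ g₂))
    ≡⟨ cong₂ (λ z → r ℕ.* z ℕ.+_) (weight-suc k) (expand gained gained-++) ⟨
  r ℕ.* weight (suc k) ℕ.+ gained (cutEdges X) ∎
  where
  open ≡-Reasoning
  open +-*-Solver
  w  = weight k
  r  = bit (X root)
  b₁ = bit (X (left root))
  b₂ = bit (X (right root))
  l₁ = link (X root) (X (left root)) k
  l₂ = link (X root) (X (right root)) k
  g₁ = gained (cutEdges (X ∘ left))
  g₂ = gained (cutEdges (X ∘ right))
  expand : (f : List CutEdge → ℕ) → (∀ l m → f (l ++ m) ≡ f l ℕ.+ f m) →
    f (cutEdges X) ≡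
    (f l₁ ℕ.+ f l₂) ℕ.+ (f (cutEdges (X ∘ left)) ℕ.+ f (cutEdges (X ∘ right)))
  expand f f-++ = trans (f-++ (l₁ ++ l₂) _)
    (cong₂ ℕ._+_ (f-++ l₁ l₂) (f-++ (cutEdges (X ∘ left)) (cutEdges (X ∘ right))))

-- Bounds on the depths of gains and losses

data Within (g l : ℕ) : CutEdge → Set where
  gain : ∀ {d} → d ℕ.< g → Within g l (gain d)
  loss : ∀ {d} → d ℕ.< l → Within g l (loss d)

Within-mono : ∀ {g g′ l l′ e} → g ℕ.≤ g′ → l ℕ.≤ l′ → Within g l e → Within g′ l′ e
Within-mono g≤g′ l≤l′ (gain d<g) = gain (ℕ.<-≤-trans d<g g≤g′)
Within-mono g≤g′ l≤l′ (loss d<l) = loss (ℕ.<-≤-trans d<l l≤l′)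

within? : ∀ g l e → Dec (Within g l e)
within? g l (gain d) = map′ gain (λ { (gain d<g) → d<g }) (d ℕ.<? g)
within? g l (loss d) = map′ loss (λ { (loss d<l) → d<l }) (d ℕ.<? l)

link-within : ∀ a b {d n} → d ℕ.< n → All (Within n n) (link a b d)
link-within false false d<n = []
link-within false true  d<n = gain d<n ∷ []
link-within true  false d<n = loss d<n ∷ []
link-within true  true  d<n = []

cutEdges-within : ∀ {k} (X : NodeSet k) → All (Within k k) (cutEdges X)
cutEdges-within {zero}  X = []
cutEdges-within {suc k} X = All.++⁺
  (All.++⁺ (link-within (X root) _ ℕ.≤-refl) (link-within (X root) _ ℕ.≤-refl))
  (All.++⁺ (All.map (Within-mono (ℕ.n≤1+n k) (ℕ.n≤1+n k)) (cutEdges-within (X ∘ left)))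
           (All.map (Within-mono (ℕ.n≤1+n k) (ℕ.n≤1+n k)) (cutEdges-within (X ∘ right))))

_⊆_ : ∀ {k} → NodeSet k → NodeSet k → Set
S ⊆ T = ∀ x → S x ≡ true → T x ≡ true

∉-⊆ : ∀ {k} {S T : NodeSet k} → S ⊆ T → ∀ x → T x ≡ false → S x ≡ false
∉-⊆ {S = S} S⊆T x x∉T with S x in x∈S
... | false = refl
... | true  = trans (sym (S⊆T x x∈S)) x∉T

link-∉ : ∀ a b {d g l} → a ≡ false → g ℕ.≤ d → All (Within g l) (link a b d) → b ≡ false
link-∉ _ false _ _ _ = refl
link-∉ false true _ g≤d (gain d<g ∷ []) = contradiction g≤d (ℕ.<⇒≱ d<g)

link-[] : ∀ {a b} d → a ≡ false → b ≡ false → link a b d ≡ []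
link-[] d refl refl = refl

-- Walking up from a node of T, one leaves T through a gain or reaches the root, so the
-- hypotheses bound the height of all nodes of T, hence of all nodes of S.
gains-⊆ : ∀ {k g l} {S T : NodeSet k} → k ℕ.≤ l → S ⊆ T → T root ≡ false →
          All (Within g l) (cutEdges T) → All (Within g l) (cutEdges S)
gains-⊆ {zero} _ _ _ _ = []
gains-⊆ {suc k} {g} {S = S} {T} k≤l S⊆T r∉T w with suc k ℕ.≤? g
-- The whole tree is low enough for every possible edge to satisfy the bounds.
... | yes k<g = All.map (Within-mono k<g k≤l) (cutEdges-within S)
-- A gain at the root of `T` would be too deep, so both children lie outside `T`; hence `S` has no
-- cut edge here, and the induction continues in the subtrees.
... | no  k≮g = All.++⁺
  (subst (All _) (sym (cong₂ _++_
    (link-[] k (∉-⊆ S⊆T root r∉T) (∉-⊆ S⊆T (left root) l∉T))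
    (link-[] k (∉-⊆ S⊆T root r∉T) (∉-⊆ S⊆T (right root) r′∉T)))) [])
  (All.++⁺
    (gains-⊆ (ℕ.<⇒≤ k≤l) (S⊆T ∘ left) l∉T (All.++⁻ˡ (cutEdges (T ∘ left)) below))
    (gains-⊆ (ℕ.<⇒≤ k≤l) (S⊆T ∘ right) r′∉T (All.++⁻ʳ (cutEdges (T ∘ left)) below)))
  where
  g≤k = ℕ.≮⇒≥ k≮g
  l₁ = link (T root) (T (left root)) k
  l₂ = link (T root) (T (right root)) k
  below = All.++⁻ʳ (l₁ ++ l₂) w
  l∉T = link-∉ (T root) _ r∉T g≤k (All.++⁻ˡ l₁ (All.++⁻ˡ (l₁ ++ l₂) w))
  r′∉T = link-∉ (T root) _ r∉T g≤k (All.++⁻ʳ l₁ (All.++⁻ˡ (l₁ ++ l₂) w))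

-- Exhaustive search over short lists of cut edges

∀list? : ∀ n g l {P : List CutEdge → Set} → (∀ es → Dec (P es)) →
         Dec (∀ es → length es ℕ.≤ n → All (Within g l) es → P es)
∀list? zero    g l P? = map′
  (λ { p [] _ _ → p }) (λ p → p [] z≤n []) (P? [])
∀list? (suc n) g l P? = map′
  (λ { (p , q , r) []            _         _            → p
     ; (p , q , r) (gain d ∷ es) (s≤s n≥es) (gain d<g ∷ w) → q d<g es n≥es w
     ; (p , q , r) (loss d ∷ es) (s≤s n≥es) (loss d<l ∷ w) → r d<l es n≥es w })
  (λ p → p [] z≤n [] ,
         (λ {d} d<g es n≥es w → p (gain d ∷ es) (s≤s n≥es) (gain d<g ∷ w)) ,
         (λ {d} d<l es n≥es w → p (loss d ∷ es) (s≤s n≥es) (loss d<l ∷ w)))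
  -- A nonempty list begins with one of g gains or l losses, and the search goes on with that edge
  -- absorbed into the predicate.
  (P? [] ×-dec ℕ.allUpTo? (λ d → ∀list? n g l (λ es → P? (gain d ∷ es))) g
         ×-dec ℕ.allUpTo? (λ d → ∀list? n g l (λ es → P? (loss d ∷ es))) l)

-- Among the signed sums of at most three numbers 2^{d+1} − 1, optionally increased by
-- #nodes 8 = 511, only 63 + 31 equals 94.
shape-94 : ∀ b es → length es ℕ.≤ 3 → All (Within 8 8) es →
           94 ℕ.+ lost es ≡ bit b ℕ.* weight 8 ℕ.+ gained es →
           b ≡ false × All (Within 6 8) es
shape-94 false = from-yes (∀list? 3 8 8 λ es →
  94 ℕ.+ lost es ℕ.≟ gained es →-dec (yes refl ×-dec All.all? (within? 6 8) es))
shape-94 true es n w eq = contradiction eq (from-yes (∀list? 3 8 8 λ es →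
  ¬? (94 ℕ.+ lost es ℕ.≟ 1 ℕ.* weight 8 ℕ.+ gained es)) es n w)

-- The only signed sum of at most four numbers 2^{d+1} − 1 equal to 89 is 127 − 31 − 7.
shape-89 : ∀ es → length es ℕ.≤ 4 → All (Within 6 8) es → 89 ℕ.+ lost es ≢ gained es
shape-89 = from-yes (∀list? 4 6 8 λ es → ¬? (89 ℕ.+ lost es ℕ.≟ gained es))

no-chain : (S T : NodeSet 8) → S ⊆ T → size S ≡ 89 → size T ≡ 94 →
           cut S ℕ.≤ 4 → cut T ℕ.≤ 3 → ⊥
no-chain S T S⊆T |S| |T| cS cT =
  shape-89 (cutEdges S) (subst (ℕ._≤ 4) (cut≡length S) cS)
    -- Gains of depth below 6 have weight at most 63, which excludes the gain of 127 that 89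
    -- requires.
    (gains-⊆ ℕ.≤-refl S⊆T r∉T gainsT)
    (balance′ S 89 false |S| (∉-⊆ S⊆T root r∉T))
  where
  balance′ : ∀ X n b → size X ≡ n → X root ≡ b →
             n ℕ.+ lost (cutEdges X) ≡ bit b ℕ.* weight 8 ℕ.+ gained (cutEdges X)
  balance′ X _ _ refl refl = balance X
  shapeT = shape-94 (T root) (cutEdges T) (subst (ℕ._≤ 3) (cut≡length T) cT)
    (cutEdges-within T) (balance′ T 94 (T root) |T| refl)
  r∉T = proj₁ shapeT
  gainsT = proj₂ shapeT

-- 94 = 63 + 31
X₉₄ : NodeSet 8
X₉₄ (left (left (left _)))          = true
X₉₄ (left (right (left (left _))))  = true
X₉₄ _                               = false

-- 89 = 127 − 31 − 7
X₈₉ : NodeSet 8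
X₈₉ (left (left (left (left _))))                   = false
X₈₉ (left (left (right (left (left (left _))))))    = false
X₈₉ (left (left _))                                 = true
X₈₉ _                                               = false

-- Sorting permutations

count : ∀ {n} → (Fin n → Bool) → ℕ
count f = Σ (bit ∘ f)

bit≤1 : ∀ b → bit b ℕ.≤ 1
bit≤1 false = z≤n
bit≤1 true  = s≤s z≤n

count≤n : ∀ {n} (f : Fin n → Bool) → count f ℕ.≤ n
count≤n {zero}  f = z≤n
count≤n {suc n} f = ℕ.+-mono-≤ (bit≤1 (f Fin.zero)) (count≤n (f ∘ Fin.suc))

toℕ-punchIn-fromℕ : ∀ {n} (i : Fin n) → toℕ (Fin.punchIn (Fin.fromℕ n) i) ≡ toℕ i
toℕ-punchIn-fromℕ Fin.zero    = refl
toℕ-punchIn-fromℕ (Fin.suc i) = cong suc (toℕ-punchIn-fromℕ i)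

-- By induction: a head with value `true` stays first, and one with value `false` moves to the last
-- position, which is not below the count.
bring-to-front : ∀ {n} (f : Fin n → Bool) → Σ[ π ∈ Permutation′ n ]
                 (∀ i → does (toℕ (π ⟨$⟩ʳ i) ℕ.<? count f) ≡ f i)
bring-to-front {zero}  f = Perm.id , λ ()
bring-to-front {suc n} f with f Fin.zero in f0≡ | bring-to-front (f ∘ Fin.suc)
... | true  | π , front = Perm.lift₀ π , λ
  { Fin.zero    → sym f0≡
  ; (Fin.suc i) → front i }
... | false | π , front = Perm.insert Fin.zero (Fin.fromℕ n) π , λ
  { Fin.zero    → trans
      (dec-false (toℕ (Fin.fromℕ n) ℕ.<? c)
        (subst (ℕ._≮ c) (sym (Fin.toℕ-fromℕ n)) (ℕ.≤⇒≯ (count≤n (f ∘ Fin.suc)))))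
      (sym f0≡)
  ; (Fin.suc i) → trans
      (cong (λ m → does (m ℕ.<? c))
        (trans (cong toℕ (Perm.insert-punchIn Fin.zero (Fin.fromℕ n) π i))
               (toℕ-punchIn-fromℕ (π ⟨$⟩ʳ i))))
      (front i) }
  where
  c = count (f ∘ Fin.suc)

-- The nodes that receive the first t houses

initial : ∀ {k} → (Node k ↔ Fin (#nodes k)) → ℕ → NodeSet k
initial π t v = does (toℕ (Inverse.to π v) ℕ.<? t)

initial-⊆ : ∀ {k} (π : Node k ↔ Fin (#nodes k)) {s t} → s ℕ.≤ t →
            initial π s ⊆ initial π t
initial-⊆ π {s} {t} s≤t v v∈ =
  dec-true (_ ℕ.<? t) (ℕ.<-≤-trans (ℕ.<ᵇ⇒< _ s (Equivalence.from T-≡ v∈)) s≤t)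

-- This makes the cut of an arbitrary set an upper bound on the optimum.
arrange : ∀ {k} (X : NodeSet k) → Σ[ π ∈ Node k ↔ Fin (#nodes k) ]
          (∀ v → initial π (size X) v ≡ X v)
arrange {k} X with bring-to-front (X ∘ node)
... | π , front = π ↔-∘ ↔-sym (nodes k) , λ v → begin
  does (toℕ (π ⟨$⟩ʳ index v) ℕ.<? size X)
    ≡⟨ cong (λ t → does (toℕ (π ⟨$⟩ʳ index v) ℕ.<? t)) (Σ-node (bit ∘ X)) ⟨
  does (toℕ (π ⟨$⟩ʳ index v) ℕ.<? count (X ∘ node))
    ≡⟨ front (index v) ⟩
  X (node (index v))
    ≡⟨ cong X (Inverse.strictlyInverseˡ (nodes k) v) ⟩
  X v ∎
  where open ≡-Reasoning

count-< : ∀ {n t} → t ℕ.≤ n → count {n} (λ i → does (toℕ i ℕ.<? t)) ≡ t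
count-< {n}     z≤n       = sum-replicate-zero n
count-< {suc n} (s≤s t≤n) = cong suc (count-< t≤n)

size-initial : ∀ {k} (π : Node k ↔ Fin (#nodes k)) {t} → t ℕ.≤ #nodes k →
               size (initial π t) ≡ t
size-initial {k} π {t} t≤n = begin
  size (initial π t)
    ≡⟨ Σ-node (bit ∘ initial π t) ⟨
  count (λ i → does (toℕ (Inverse.to π (node i)) ℕ.<? t))
    ≡⟨ sum-permute (λ i → bit (does (toℕ i ℕ.<? t))) (π ↔-∘ nodes k) ⟨
  count {#nodes k} (λ i → does (toℕ i ℕ.<? t))
    ≡⟨ count-< t≤n ⟩
  t ∎
  where open ≡-Reasoning

-- Instances with house values in {0, 1}

ι : ℕ → ℚ
ι zero    = 0ℚ
ι (suc n) = 1ℚ ℚ.+ ι n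

ι-+ : ∀ m n → ι (m ℕ.+ n) ≡ ι m ℚ.+ ι n
ι-+ zero    n = sym (ℚ.+-identityˡ (ι n))
ι-+ (suc m) n = trans (cong (1ℚ ℚ.+_) (ι-+ m n)) (sym (ℚ.+-assoc 1ℚ (ι m) (ι n)))

ι-nonneg : ∀ n → 0ℚ ℚ.≤ ι n
ι-nonneg zero    = ℚ.≤-refl
ι-nonneg (suc n) = ℚ.+-mono-≤ (ℚ.nonNegative⁻¹ 1ℚ) (ι-nonneg n)

ι-mono : ∀ {m n} → m ℕ.≤ n → ι m ℚ.≤ ι n
ι-mono {n = n} z≤n = ι-nonneg n
ι-mono (s≤s m≤n)   = ℚ.+-monoʳ-≤ 1ℚ (ι-mono m≤n)

-- The envies of 0/1 instances have constant sequences, so comparing them reduces to comparing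
-- rationals.
constant-≤ : ∀ x y {p q} → (∀ N → seq x N ≡ p) → (∀ N → seq y N ≡ q) → p ℚ.≤ q → x ≤ y
constant-≤ _ _ {q = q} x≡ y≡ p≤q ε 0<ε = 0 , λ N _ →
  subst₂ (λ a b → a ℚ.≤ b ℚ.+ ε) (sym (x≡ N)) (sym (y≡ N))
    (ℚ.≤-trans p≤q (subst (ℚ._≤ q ℚ.+ ε) (ℚ.+-identityʳ q) (ℚ.+-monoʳ-≤ q (ℚ.<⇒≤ 0<ε))))

fromℚ-mono : ∀ {p q} → p ℚ.≤ q → fromℚ p ≤ fromℚ q
fromℚ-mono {p} {q} = constant-≤ (fromℚ p) (fromℚ q) (λ _ → refl) (λ _ → refl)

step : ∀ {n} → ℕ → Houses n
step t = record
  { value  = λ i → fromℚ (ι (bit (not (does (toℕ i ℕ.<? t)))))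
  ; nonneg = λ i → fromℚ-mono (ι-nonneg (bit (not (does (toℕ i ℕ.<? t)))))
  ; sorted = λ i≤j → fromℚ-mono (ι-mono (ascending i≤j))
  }
  where
  ascending : ∀ {i j} → i ℕ.≤ j →
    bit (not (does (i ℕ.<? t))) ℕ.≤ bit (not (does (j ℕ.<? t)))
  ascending {i} {j} i≤j with i ℕ.<ᵇ t in i<?t | j ℕ.<ᵇ t in j<?t
  ... | true  | _     = z≤n
  ... | false | false = s≤s z≤n
  ... | false | true  = contradiction
    (trans (sym i<?t) (dec-true (i ℕ.<? t)
      (ℕ.≤-<-trans i≤j (ℕ.<ᵇ⇒< j t (Equivalence.from T-≡ j<?t)))))
    λ ()

seq-sum : ∀ {n} (f : Fin n → ℝ) (g : Fin n → ℕ) N →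
          (∀ i → seq (f i) N ≡ ι (g i)) → seq (sum f) N ≡ ι (Σ g)
seq-sum {zero}  f g N eq = refl
seq-sum {suc n} f g N eq = trans
  (cong₂ ℚ._+_ (eq Fin.zero) (seq-sum (f ∘ Fin.suc) (g ∘ Fin.suc) N (eq ∘ Fin.suc)))
  (sym (ι-+ (g Fin.zero) (Σ (g ∘ Fin.suc))))

∣ι-ι∣ : ∀ a b → ℚ.∣ ι (bit (not a)) ℚ.- ι (bit (not b)) ∣ ≡ ι (bit (a xor b))
∣ι-ι∣ false false = refl
∣ι-ι∣ false true  = refl
∣ι-ι∣ true  false = refl
∣ι-ι∣ true  true  = refl

seq-if : ∀ b {x} {m} N → seq x N ≡ ι m →
         seq (if b then x else 0ℝ) N ≡ ι (if b then m else 0)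
seq-if true  N eq = eq
seq-if false N eq = refl

-- In the preorder numbering a parent precedes its children, so i < j picks the child.
does-edge : ∀ {k} (i j : Fin (#nodes k)) →
  does (i Fin.<? j ×-dec Graph._~?_ (B k) (node i) (node j)) ≡
  does (child? (node {k} i) (node j))
does-edge {k} i j = does-⇔
  (mk⇔ (λ { (_ , inj₁ c) → c
          ; (i<j , inj₂ c) → contradiction (node-mono {k} c) (ℕ.<⇒≯ i<j) })
       (λ c → node-mono {k} c , inj₁ c))
  (i Fin.<? j ×-dec Graph._~?_ (B k) (node i) (node j)) (child? (node i) (node j))

-- An edge contributes 1 if exactly one endpoint receives a house of value 0, and 0 otherwise.
envy-step : ∀ {k} (π : Allocation (B k)) t N →
            seq (envy (B k) (step t) π) N ≡ ι (cut (initial π t))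
envy-step {k} π t N = trans
  (seq-sum _ _ N λ i → seq-sum _ (term i) N λ j →
    seq-if (does (i Fin.<? j ×-dec Graph._~?_ (B k) (node i) (node j))) N
      (∣ι-ι∣ (X (node i)) (X (node j))))
  (cong ι (begin
    Σ (λ i → Σ (term i))
      ≡⟨ sum-cong-≗ (λ i → sum-cong-≗ λ j →
           cong (λ b → if b then bit (X (node i) xor X (node j)) else 0) (does-edge {k} i j)) ⟩
    Σ (λ i → Σ (below (node i) ∘ node))
      ≡⟨ sum-cong-≗ (λ i → Σ-node (below (node i))) ⟩
    Σ (cutBelow X ∘ node)
      ≡⟨ Σ-node (cutBelow X) ⟩
    cut X ∎))
  where
  open ≡-Reasoning
  X = initial π t
  term : Fin (#nodes k) → Fin (#nodes k) → ℕ
  term i j = if does (i Fin.<? j ×-dec Graph._~?_ (B k) (node i) (node j))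
             then bit (X (node i) xor X (node j)) else 0
  below : Node k → Node k → ℕ
  below x y = if does (child? x y) then bit (X x xor X y) else 0

cut-cong : ∀ {k} {X Y : NodeSet k} → (∀ v → X v ≡ Y v) → cut X ≡ cut Y
cut-cong eq = Σᵀ-cong λ x → Σᵀ-cong λ y →
  cong₂ (λ a b → if does (child? x y) then bit (a xor b) else 0) (eq x) (eq y)

-- The approximation ratio

-- Without a minimum, every value could be undercut, giving an infinite descent. The double negation
-- spares an enumeration of `A`.
least : ∀ {A : Set} (f : A → ℕ) a → ¬ ¬ (∃[ b ] (f b ℕ.≤ f a × (∀ c → f b ℕ.≤ f c)))
least f a none = descend a (<-wellFounded (f a)) ℕ.≤-refl
  where
  descend : ∀ b → Acc ℕ._<_ (f b) → f b ℕ.≤ f a → ⊥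
  descend b (acc smaller) fb≤fa = none (b , fb≤fa , λ c → ℕ.≮⇒≥ λ fc<fb →
    descend c (smaller fc<fb) (ℕ.≤-trans (ℕ.<⇒≤ fc<fb) fb≤fa))

-- For e > 0, c ≤ αe < re ≤ rE ≤ b + 1, and integrality turns c < b + 1 into c ≤ b.
ratio-bound : ∀ {α r} → α < fromℚ r → .{{ℚ.NonNegative r}} →
  ∀ x {c e E b} → (∀ N → seq x N ≡ ι c) → x ≤ α * fromℚ (ι e) → e ℕ.≤ E →
  r ℚ.* ι E ℚ.≤ ι (suc b) → c ℕ.≤ b
-- For e = 0 multiplication by e loses strictness; instead, tolerance ½ rules out c ≥ 1.
ratio-bound {α} _ x {c} {zero} {b = b} x≡ x≤ _ _
  with x≤ ½ (ℚ.positive⁻¹ ½)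
... | N , bound = s≤s⁻¹ (ℕ.≰⇒> λ b<c → ℚ.<-irrefl refl (begin-strict
  1ℚ                       ≤⟨ ι-mono {1} {suc b} (s≤s z≤n) ⟩
  ι (suc b)                ≤⟨ ι-mono b<c ⟩
  ι c                      ≡⟨ x≡ N ⟨
  seq x N                  ≤⟨ bound N ℕ.≤-refl ⟩
  seq α N ℚ.* 0ℚ ℚ.+ ½     ≡⟨ cong (ℚ._+ ½) (ℚ.*-zeroʳ (seq α N)) ⟩
  ½                        <⟨ from-yes (½ ℚ.<? 1ℚ) ⟩
  1ℚ                       ∎))
  where open ℚ.≤-Reasoning
ratio-bound {α} {r} (ε , 0<ε , M , below) x {c} {e@(suc e-1)} {E} {b} x≡ x≤ e≤E rE≤b
  with ℚ.<-dense 0<ε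
-- The tolerance is chosen strictly inside the gap ε between α and r; since e ≥ 1, ε is at most ε
-- times e and fits into re.
... | δ , 0<δ , δ<ε with x≤ δ 0<δ
... | N , bound = s≤s⁻¹ (ℕ.≰⇒> λ b<c → ℚ.<-irrefl refl (begin-strict
  ι (suc b)                               ≤⟨ ι-mono b<c ⟩
  ι c                                     ≡⟨ x≡ K ⟨
  seq x K                                 ≤⟨ bound K (ℕ.m≤n⊔m M N) ⟩
  seq α K ℚ.* ι e ℚ.+ δ                   <⟨ ℚ.+-monoʳ-< (seq α K ℚ.* ι e) δ<ε ⟩
  seq α K ℚ.* ι e ℚ.+ ε                   ≡⟨ cong (seq α K ℚ.* ι e ℚ.+_) (ℚ.*-identityʳ ε) ⟨
  seq α K ℚ.* ι e ℚ.+ ε ℚ.* 1ℚ            ≤⟨ ℚ.+-monoʳ-≤ (seq α K ℚ.* ι e)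
                                               (ℚ.*-monoˡ-≤-nonNeg ε (ι-mono {1} {e} (s≤s z≤n))) ⟩
  seq α K ℚ.* ι e ℚ.+ ε ℚ.* ι e           ≡⟨ ℚ.*-distribʳ-+ (ι e) (seq α K) ε ⟨
  (seq α K ℚ.+ ε) ℚ.* ι e                 ≤⟨ ℚ.*-monoʳ-≤-nonNeg (ι e) (below K (ℕ.m≤m⊔n M N)) ⟩
  r ℚ.* ι e                               ≤⟨ ℚ.*-monoˡ-≤-nonNeg r (ι-mono e≤E) ⟩
  r ℚ.* ι E                               ≤⟨ rE≤b ⟩
  ι (suc b)                               ∎))
  where
  open ℚ.≤-Reasoning
  K = M ℕ.⊔ N
  instance
    ε-nonNeg : ℚ.NonNegative ε
    ε-nonNeg = ℚ.nonNegative (ℚ.<⇒≤ 0<ε)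
    ιe-nonNeg : ℚ.NonNegative (ι e)
    ιe-nonNeg = ℚ.nonNegative (ι-nonneg e)

integral-envy-bound : ∀ {α r} → α < fromℚ r → .{{ℚ.NonNegative r}} →
  ∀ G H (f : Allocation G → ℕ) → (∀ π N → seq (envy G H π) N ≡ ι (f π)) →
  ∀ πᴬ → (∀ m → IsMinimumEnvy G H m → envy G H πᴬ ≤ α * m) →
  ∀ π {b} → r ℚ.* ι (f π) ℚ.≤ ι (suc b) → f πᴬ ℕ.≤ b
integral-envy-bound {α} α<r G H f envy≡ πᴬ approx π {b} rf≤b =
  -- The goal is decidable, so a minimum known only under double negation suffices.
  decidable-stable (f πᴬ ℕ.≤? b) λ exceeds → least f π λ (π₀ , π₀≤π , π₀-least) →
    exceeds (ratio-bound {α} α<r (envy G H πᴬ) {f πᴬ} {f π₀} {f π} {b} (envy≡ πᴬ)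
      (approx (fromℚ (ι (f π₀)))
        ( (π₀ , constant-≤ (envy G H π₀) (fromℚ (ι (f π₀))) (envy≡ π₀) (λ _ → refl) ℚ.≤-refl
              , constant-≤ (fromℚ (ι (f π₀))) (envy G H π₀) (λ _ → refl) (envy≡ π₀) ℚ.≤-refl)
        , λ ρ → constant-≤ (fromℚ (ι (f π₀))) (envy G H ρ) (λ _ → refl) (envy≡ ρ)
                  (ι-mono (π₀-least ρ))))
      π₀≤π rf≤b)

-- The optimum on the step instance is at most cut X, since X can be given the houses
-- of value 0.
cut-bound : ∀ {k α r} → α < fromℚ r → .{{ℚ.NonNegative r}} →
  (A : Algorithm CompleteBinaryTree) → IsApproximation α A →
  (Bₖ : CompleteBinaryTree (B k)) (X : NodeSet k) {b : ℕ} →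
  r ℚ.* ι (cut X) ℚ.≤ ι (suc b) →
  cut (initial (A (B k) Bₖ (step (size X))) (size X)) ℕ.≤ b
cut-bound {k} {α} {r} α<r A approx Bₖ X {b} rX≤b = integral-envy-bound {α} α<r
  (B k) (step t) (λ π → cut (initial π t)) (λ π → envy-step π t)
  (A (B k) Bₖ (step t)) (approx (B k) Bₖ (step t)) (proj₁ (arrange X)) {b}
  (subst (λ c → r ℚ.* ι c ℚ.≤ ι (suc b)) (sym (cut-cong (proj₂ (arrange X)))) rX≤b)
  where
  t = size X

proposition5p4 : (α : ℝ) → α < fromℚ (+ 5 / 3) →
    (A : Algorithm CompleteBinaryTree) → ValueAgnostic A → ¬ IsApproximation α A
proposition5p4 α α<5/3 A agnostic approx = no-chain (initial π 89) (initial π 94)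
  (initial-⊆ π {89} {94} (ℕ.m≤m+n 89 5))
  -- Both sums are 511, the number of nodes of `B 8`.
  (size-initial π {89} (ℕ.m≤m+n 89 422)) (size-initial π {94} (ℕ.m≤m+n 94 417))
  -- The critical instance: 5/3 times 3 is exactly 5, and strictness of α < 5/3 leaves a cut of at
  -- most 4. For 94, 10/3 ≤ 4 leaves at most 3.
  (bound X₈₉ 89 3 4 refl refl (from-yes (5/3 ℚ.* ι 3 ℚ.≤? ι 5)))
  (bound X₉₄ 94 2 3 refl refl (from-yes (5/3 ℚ.* ι 2 ℚ.≤? ι 4)))
  where
  5/3 = + 5 / 3
  B₈ : CompleteBinaryTree (B 8)
  B₈ = 8 , record { bijection = ↔-id (Node 8) ; preserves = λ _ _ → mk⇔ id id }
  -- One ordering serves both instances, which is what makes the two sets nested.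
  order = proj₁ (agnostic (B 8) B₈)
  π : Node 8 ↔ Fin (#nodes 8)
  π = ↔-sym order
  A≡π : ∀ H v → Inverse.to (A (B 8) B₈ H) v ≡ Inverse.to π v
  A≡π H v = trans (cong (Inverse.to (A (B 8) B₈ H)) (sym (Inverse.strictlyInverseˡ order v)))
                  (proj₂ (agnostic (B 8) B₈) H (Inverse.to π v))
  bound : ∀ X t c b → size X ≡ t → length (cutEdges X) ≡ c →
          5/3 ℚ.* ι c ℚ.≤ ι (suc b) → cut (initial π t) ℕ.≤ b
  bound X _ _ b refl refl 5c/3≤b = subst (ℕ._≤ b)
    (cut-cong λ v → cong (λ i → does (toℕ i ℕ.<? size X)) (A≡π (step (size X)) v))
    (cut-bound {α = α} {r = 5/3} α<5/3 A approx B₈ X {b}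
      (subst (λ c → 5/3 ℚ.* ι c ℚ.≤ ι (suc b)) (sym (cut≡length X)) 5c/3≤b))
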